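{- Let $G$ be an edge-colored graph on $n$ vertices. If $d^{c}(v)\geq n/2$ for every vertex $v\in V(G)$ and $G$ contains no rainbow triangles, then either $n$ is even and $G$ is (as an uncolored graph, up to isomorphism) the complete bipartite graph $K_{n/2,n/2}$, or $n=4$ and $G$ is (as an uncolored graph, up to isomorphism) $K_4-e$ or $K_4$.
   Context: All graphs are simple and finite. An edge-colored graph is a graph $G=(V,E)$ together with an arbitrary mapping $C:E\to\mathbb{N}$ (not required to be a proper edge-coloring). For a vertex $v$ of $G$, the color degree $d^c(v)$ is the number of distinct colors appearing on the edges incident to $v$. A rainbow triangle is a triangle of $G$ whose three edges have pairwise distinct colors. $K_4-e$ denotes the complete graph $K_4$ with one edge deleted. -}

module Defs where

open import Data.Empty using (⊥)
open import Data.Fin.Base using (Fin; zero; suc)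
import Data.Fin.Properties as Fin
open import Data.List.Base using (List; length; mapMaybe; allFin; deduplicate)
import Data.Maybe.Base as Maybe
open import Data.Nat.Base using (ℕ)
import Data.Nat.Properties as ℕ
open import Data.Product.Base using (Σ-syntax; ∃-syntax; _×_; _,_; swap)
open import Data.Sum.Base using (_⊎_; inj₁; inj₂)
open import Data.Unit.Base using (⊤; tt)
open import Function.Base using (_∘_)
open import Function.Bundles using (_↔_; _⇔_; Inverse)
open import Level using (0ℓ)
open import Relation.Binary.Core using (Rel)
open import Relation.Binary.Definitions using (Symmetric; Irreflexive; Decidable)
open import Relation.Binary.PropositionalEquality.Core using (_≡_; _≢_; refl; ≢-sym)
open import Relation.Nullary.Decidable.Core using (yes; no; dec⇒maybe; ¬?; _×-dec_)
open import Relation.Nullary.Negation.Core using (¬_)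

record SimpleGraph (V : Set) : Set₁ where
  field
    Adj    : Rel V 0ℓ
    sym    : Symmetric Adj
    irrefl : Irreflexive _≡_ Adj
    adj?   : Decidable Adj

-- An arbitrary map from the (undirected) edges to ℕ.  Since every edge has a
-- reversal, `undirected` also makes `colour` independent of the choice of
-- proof of adjacency.
record EdgeColouring {V : Set} (G : SimpleGraph V) : Set where
  open SimpleGraph G
  field
    colour     : ∀ {u v} → Adj u v → ℕ
    undirected : ∀ {u v} (e : Adj u v) (e′ : Adj v u) → colour e ≡ colour e′

module _ {n : ℕ} {G : SimpleGraph (Fin n)} (C : EdgeColouring G) where
  open SimpleGraph G
  open EdgeColouring C

  incidentColours : Fin n → List ℕ
  incidentColours v =
    mapMaybe (λ u → Maybe.map colour (dec⇒maybe (adj? v u))) (allFin n)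

  colourDegree : Fin n → ℕ
  colourDegree v = length (deduplicate ℕ._≟_ (incidentColours v))

-- The three vertices are automatically distinct, by irreflexivity.
HasRainbowTriangle : {V : Set} {G : SimpleGraph V} → EdgeColouring G → Set
HasRainbowTriangle {G = G} C =
  ∃[ x ] ∃[ y ] ∃[ z ]
  Σ[ xy ∈ Adj x y ] Σ[ yz ∈ Adj y z ] Σ[ xz ∈ Adj x z ]
    colour xy ≢ colour yz × colour yz ≢ colour xz × colour xy ≢ colour xz
  where
  open SimpleGraph G
  open EdgeColouring C

infix 4 _≅_

record _≅_ {V W : Set} (G : SimpleGraph V) (H : SimpleGraph W) : Set where
  private
    module G = SimpleGraph G
    module H = SimpleGraph H
  field
    vertices : V ↔ W
  open Inverse vertices using (to)
  field
    adjacency : ∀ u v → G.Adj u v ⇔ H.Adj (to u) (to v)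

complete : ∀ n → SimpleGraph (Fin n)
complete n = record
  { Adj    = _≢_
  ; sym    = ≢-sym
  ; irrefl = λ x≡y x≢y → x≢y x≡y
  ; adj?   = λ x y → ¬? (x Fin.≟ y)
  }

completeBipartite : ∀ m n → SimpleGraph (Fin m ⊎ Fin n)
completeBipartite m n = record
  { Adj    = Adj
  ; sym    = λ {x} {y} → sym x y
  ; irrefl = irrefl
  ; adj?   = adj?
  }
  where
  Adj : Rel (Fin m ⊎ Fin n) 0ℓ
  Adj (inj₁ _) (inj₂ _) = ⊤
  Adj (inj₂ _) (inj₁ _) = ⊤
  Adj (inj₁ _) (inj₁ _) = ⊥
  Adj (inj₂ _) (inj₂ _) = ⊥

  sym : ∀ x y → Adj x y → Adj y x
  sym (inj₁ _) (inj₂ _) _ = tt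
  sym (inj₂ _) (inj₁ _) _ = tt

  irrefl : Irreflexive _≡_ Adj
  irrefl {inj₁ _} refl ()
  irrefl {inj₂ _} refl ()

  adj? : Decidable Adj
  adj? (inj₁ _) (inj₂ _) = yes tt
  adj? (inj₂ _) (inj₁ _) = yes tt
  adj? (inj₁ _) (inj₁ _) = no λ ()
  adj? (inj₂ _) (inj₂ _) = no λ ()

deleteEdge : ∀ {n} → SimpleGraph (Fin n) → Fin n → Fin n → SimpleGraph (Fin n)
deleteEdge G u v = record
  { Adj    = λ x y → G.Adj x y × ¬ (x ≡ u × y ≡ v) × ¬ (x ≡ v × y ≡ u)
  ; sym    = λ (e , p , q) → G.sym e , q ∘ swap , p ∘ swap
  ; irrefl = λ x≡y (e , _) → G.irrefl x≡y e
  ; adj?   = λ x y → G.adj? x y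
               ×-dec ¬? ((x Fin.≟ u) ×-dec (y Fin.≟ v))
               ×-dec ¬? ((x Fin.≟ v) ×-dec (y Fin.≟ u))
  }
  where module G = SimpleGraph G

K₄ : SimpleGraph (Fin 4)
K₄ = complete 4

K₄-e : SimpleGraph (Fin 4)
K₄-e = deleteEdge K₄ zero (suc zero)

{-# OPTIONS --safe #-}
module Submission where

-- Deleting edges whose colour occurs again at both ends, we get a spanning subgraph H with
-- the same colours at every vertex, in which every edge has a colour occurring once ("lone")
-- at one of its ends.  For a vertex v let d be its degree in H, f the number of its edges
-- whose colour is not lone at v, and a the number of its edges whose colour is not lone at
-- the other end.  Counting colours at v gives n + f ≤ 2d; counting colours at a suitable
-- neighbour, using that triangles are not rainbow, gives 2d ≤ n + a, strictly if a > 0.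
-- Summed over v the numbers f and a have equal totals, so a = 0 and 2d = n throughout: H is
-- properly coloured, hence triangle-free, and n/2-regular, so it is K_{n/2,n/2}.  An edge xy
-- of G inside a part forces its colour on xz or yz for all z opposite, so n/2 ≤ 2.

open import Data.Bool.Base using (if_then_else_)
open import Data.Empty using (⊥-elim)
open import Data.Fin.Base using (Fin; zero; suc)
import Data.Fin.Base as Fin
open import Data.Fin.Patterns using (0F; 1F; 2F; 3F)
import Data.Fin.Properties as Fin
open import Data.List.Base using (List; []; _∷_; allFin; cartesianProduct; deduplicate; length; lookup)
open import Data.List.Membership.Propositional using (_∈_)
open import Data.List.Membership.Propositional.Properties
  using (∈-allFin; ∈-cartesianProduct⁺; ∈-deduplicate⁻; ∈-lookup)
open import Data.List.Relation.Unary.All using (All; _∷_)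
import Data.List.Relation.Unary.All as All
import Data.List.Relation.Unary.All.Properties as All
open import Data.List.Relation.Unary.AllPairs using (_∷_)
open import Data.List.Relation.Unary.Any using (here; there)
open import Data.List.Relation.Unary.Unique.DecPropositional.Properties using (deduplicate-!)
open import Data.List.Relation.Unary.Unique.Propositional using (Unique)
import Data.Maybe.Base as Maybe
import Data.Maybe.Relation.Unary.All as Maybe using (All; just; nothing)
open import Data.Nat.Base
  using (ℕ; zero; suc; _+_; _*_; _/_; _≤_; _<_; z≤n; s≤s)
open import Data.Nat.Divisibility using (_∣_; divides)
open import Data.Nat.DivMod using (m*n/n≡m)
open import Data.Nat.Properties
open import Data.Nat.Tactic.RingSolver using (solve-∀)
open import Data.Product.Base using (∃-syntax; ∃; _×_; _,_; proj₁; proj₂)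
open import Data.Sum.Base using (_⊎_; inj₁; inj₂; [_,_]′)
import Data.Sum.Base as Sum
import Data.Sum.Properties as Sum
open import Data.Sum.Properties using (inj₁-injective)
open import Data.Unit.Base using (tt)
open import Function.Base using (_∘_; id)
open import Function.Bundles using (_↔_; _⇔_; Inverse; Equivalence; mk↔ₛ′; mk⇔)
open import Function.Properties.Inverse using (↔-sym; ↔-trans)
open import Level using (0ℓ)
open import Relation.Binary.PropositionalEquality
open import Relation.Nullary
open import Relation.Nullary.Decidable using (dec⇒maybe; decidable-stable)
open import Relation.Unary using (Pred; Decidable; _⊆_; _∪_; _∩_; ∁)
open import Relation.Unary.Properties using (_∪?_; _∩?_; ∁?)

open import Defs
open import Algebra.Properties.Semiring.Sum +-*-semiring
  using (sum; sum-cong-≗; ∑-distrib-+; ∑-comm; *-distribˡ-sum; *-distribʳ-sum)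

-- Sums, indicators and counts over `Fin n`.

private
  variable
    n : ℕ
    P Q : Pred (Fin n) 0ℓ

sum-mono-≤ : {f g : Fin n → ℕ} → (∀ i → f i ≤ g i) → sum f ≤ sum g
sum-mono-≤ {zero}  f≤g = z≤n
sum-mono-≤ {suc n} f≤g = +-mono-≤ (f≤g zero) (sum-mono-≤ (f≤g ∘ suc))

sum-mono-< : {f g : Fin n → ℕ} → (∀ i → f i ≤ g i) → ∀ i → f i < g i → sum f < sum g
sum-mono-< f≤g zero    fi<gi = +-mono-<-≤ fi<gi (sum-mono-≤ (f≤g ∘ suc))
sum-mono-< f≤g (suc i) fi<gi = +-mono-≤-< (f≤g zero) (sum-mono-< (f≤g ∘ suc) i fi<gi)

sum-const : ∀ n k → sum {n} (λ _ → k) ≡ n * k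
sum-const zero    k = refl
sum-const (suc n) k = cong (k +_) (sum-const n k)

𝟙 : {A : Set} → Dec A → ℕ
𝟙 a? = if does a? then 1 else 0

𝟙-mono : {A B : Set} (a? : Dec A) (b? : Dec B) → (A → B) → 𝟙 a? ≤ 𝟙 b?
𝟙-mono (no  _) b?      a⇒b = z≤n
𝟙-mono (yes a) (yes _) a⇒b = ≤-refl
𝟙-mono (yes a) (no ¬b) a⇒b = contradiction (a⇒b a) ¬b

𝟙-disjoint : {A B R : Set} (a? : Dec A) (b? : Dec B) (r? : Dec R) →
             (A → R) → (B → R) → ¬ (A × B) → 𝟙 a? + 𝟙 b? ≤ 𝟙 r?
𝟙-disjoint (no  _) b?      r? a⇒r b⇒r ¬ab = 𝟙-mono b? r? b⇒r
𝟙-disjoint (yes a) (no  _) r? a⇒r b⇒r ¬ab = 𝟙-mono (yes a) r? a⇒r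
𝟙-disjoint (yes a) (yes b) r? a⇒r b⇒r ¬ab = contradiction (a , b) ¬ab

𝟙-× : {A B : Set} (a? : Dec A) (b? : Dec B) → 𝟙 (a? ×-dec b?) ≡ 𝟙 a? * 𝟙 b?
𝟙-× (no  _) b?      = refl
𝟙-× (yes _) (no  _) = refl
𝟙-× (yes _) (yes _) = refl

-- The bound is asked for only where `A` holds, so that an inequality known at centres can be summed
-- over all vertices.
𝟙-*-≤ : {A : Set} (a? : Dec A) {k l m : ℕ} → (A → k ≤ l + m) → 𝟙 a? * k ≤ 𝟙 a? * l + m
𝟙-*-≤ (no  _)         bound = z≤n
𝟙-*-≤ (yes a) {k} {l} bound rewrite +-identityʳ k | +-identityʳ l = bound a

𝟙-yes : {A : Set} (a? : Dec A) → A → 𝟙 a? ≡ 1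
𝟙-yes (yes _) a = refl
𝟙-yes (no ¬a) a = contradiction a ¬a

𝟙-no : {A : Set} (a? : Dec A) → ¬ A → 𝟙 a? ≡ 0
𝟙-no (yes a) ¬a = contradiction a ¬a
𝟙-no (no  _) ¬a = refl

-- A sum of indicators, so that double counting becomes an exchange of two sums.
# : {P : Pred (Fin n) 0ℓ} → Decidable P → ℕ
# P? = sum (𝟙 ∘ P?)

#-mono : (P? : Decidable P) (Q? : Decidable Q) → P ⊆ Q → # P? ≤ # Q?
#-mono P? Q? P⊆Q = sum-mono-≤ λ i → 𝟙-mono (P? i) (Q? i) P⊆Q

#-empty : (P? : Decidable P) → (∀ i → ¬ P i) → # P? ≡ 0
#-empty {n} P? ¬P =
  trans (sum-cong-≗ λ i → 𝟙-no (P? i) (¬P i)) (trans (sum-const n 0) (*-zeroʳ n))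

#-∪-∩ : (P? : Decidable P) (Q? : Decidable Q) →
        # (P? ∪? Q?) + # (P? ∩? Q?) ≡ # P? + # Q?
#-∪-∩ P? Q? = trans (sym (∑-distrib-+ (𝟙 ∘ (P? ∪? Q?)) (𝟙 ∘ (P? ∩? Q?))))
                    (trans (sum-cong-≗ pointwise) (∑-distrib-+ (𝟙 ∘ P?) (𝟙 ∘ Q?)))
  where
  pointwise : ∀ i → 𝟙 ((P? ∪? Q?) i) + 𝟙 ((P? ∩? Q?) i) ≡ 𝟙 (P? i) + 𝟙 (Q? i)
  pointwise i with P? i | Q? i
  ... | yes _ | yes _ = refl
  ... | yes _ | no  _ = refl
  ... | no  _ | yes _ = refl
  ... | no  _ | no  _ = refl

#-∁ : ∀ {n} {P : Pred (Fin n) 0ℓ} (P? : Decidable P) → # P? + # (∁? P?) ≡ n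
#-∁ {n} P? = trans (sym (∑-distrib-+ (𝟙 ∘ P?) (𝟙 ∘ ∁? P?)))
                   (trans (sum-cong-≗ pointwise) (trans (sum-const n 1) (*-identityʳ n)))
  where
  pointwise : ∀ i → 𝟙 (P? i) + 𝟙 (∁? P? i) ≡ 1
  pointwise i with P? i
  ... | yes _ = refl
  ... | no  _ = refl

#-disjoint-< : ∀ {n} {P Q : Pred (Fin n) 0ℓ} (P? : Decidable P) (Q? : Decidable Q) → (∀ i → ¬ (P i × Q i)) →
               ∀ i → ¬ P i → ¬ Q i → # P? + # Q? < n
#-disjoint-< {n} P? Q? disjoint i ¬p ¬q = begin-strict
  # P? + # Q?                        ≡⟨ ∑-distrib-+ (𝟙 ∘ P?) (𝟙 ∘ Q?) ⟨
  sum (λ j → 𝟙 (P? j) + 𝟙 (Q? j))    <⟨ sum-mono-< (λ j → 𝟙-disjoint (P? j) (Q? j) (yes tt) _ _ (disjoint j)) i at-i ⟩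
  sum {n} (λ _ → 1)                  ≡⟨ trans (sum-const n 1) (*-identityʳ n) ⟩
  n                                  ∎
  where
  open ≤-Reasoning
  at-i : 𝟙 (P? i) + 𝟙 (Q? i) < 1
  at-i rewrite 𝟙-no (P? i) ¬p | 𝟙-no (Q? i) ¬q = ≤-refl

least : (P? : Decidable P) → ∃ P → ∃[ i ] P i × (∀ j → j Fin.< i → ¬ P j)
least {suc n} P? (i , p) with P? zero
... | yes p₀ = zero , p₀ , λ _ ()
least {suc n} P? (zero  , p) | no ¬p₀ = contradiction p ¬p₀
least {suc n} {P} P? (suc i , p) | no ¬p₀ with j , pⱼ , below ← least (P? ∘ suc) (i , p) =
  suc j , pⱼ , λ { zero _ → ¬p₀ ; (suc k) (s≤s k<j) → below k k<j }

-- Numbering a decidable subset of `Fin n` and its complement.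

record Partition {n} (P : Pred (Fin n) 0ℓ) (a b : ℕ) : Set where
  field
    parts : Fin n ↔ (Fin a ⊎ Fin b)
  open Inverse parts public
  field
    part : ∀ i → (P i × ∃[ k ] to i ≡ inj₁ k) ⊎ (¬ P i × ∃[ k ] to i ≡ inj₂ k)

-- Induction in step with `sum`: `zero` goes in front of the side it belongs to, and `cons` shifts
-- the indices on that side only.
partition : ∀ {n} {P : Pred (Fin n) 0ℓ} (P? : Decidable P) → Partition P (# P?) (# (∁? P?))
partition {zero} P? = record
  { parts = mk↔ₛ′ (λ ()) (λ { (inj₁ ()) ; (inj₂ ()) }) (λ { (inj₁ ()) ; (inj₂ ()) }) (λ ())
  ; part  = λ ()
  }
partition {suc n} {P} P? with P? zero | partition (P? ∘ suc)
... | yes p₀ | tl = record { parts = mk↔ₛ′ to from invˡ invʳ ; part = part }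
  where
  module T = Partition tl
  A = # (P? ∘ suc)
  B = # (∁? (P? ∘ suc))
  cons : Fin A ⊎ Fin B → Fin (suc A) ⊎ Fin B
  cons (inj₁ k) = inj₁ (suc k)
  cons (inj₂ k) = inj₂ k
  to : Fin (suc n) → Fin (suc A) ⊎ Fin B
  to zero    = inj₁ zero
  to (suc i) = cons (T.to i)
  from : Fin (suc A) ⊎ Fin B → Fin (suc n)
  from (inj₁ zero)    = zero
  from (inj₁ (suc k)) = suc (T.from (inj₁ k))
  from (inj₂ k)       = suc (T.from (inj₂ k))
  from-cons : ∀ s → from (cons s) ≡ suc (T.from s)
  from-cons (inj₁ _) = refl
  from-cons (inj₂ _) = refl
  invˡ : ∀ s → to (from s) ≡ s
  invˡ (inj₁ zero)    = refl
  invˡ (inj₁ (suc k)) = cong cons (T.strictlyInverseˡ (inj₁ k))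
  invˡ (inj₂ k)       = cong cons (T.strictlyInverseˡ (inj₂ k))
  invʳ : ∀ i → from (to i) ≡ i
  invʳ zero    = refl
  invʳ (suc i) = trans (from-cons (T.to i)) (cong suc (T.strictlyInverseʳ i))
  part : ∀ i → (P i × ∃[ k ] to i ≡ inj₁ k) ⊎ (¬ P i × ∃[ k ] to i ≡ inj₂ k)
  part zero = inj₁ (p₀ , zero , refl)
  part (suc i) with T.part i
  ... | inj₁ (p , k , eq)  = inj₁ (p , suc k , cong cons eq)
  ... | inj₂ (¬p , k , eq) = inj₂ (¬p , k , cong cons eq)
... | no ¬p₀ | tl = record { parts = mk↔ₛ′ to from invˡ invʳ ; part = part }
  where
  module T = Partition tl
  A = # (P? ∘ suc)
  B = # (∁? (P? ∘ suc))
  cons : Fin A ⊎ Fin B → Fin A ⊎ Fin (suc B)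
  cons (inj₁ k) = inj₁ k
  cons (inj₂ k) = inj₂ (suc k)
  to : Fin (suc n) → Fin A ⊎ Fin (suc B)
  to zero    = inj₂ zero
  to (suc i) = cons (T.to i)
  from : Fin A ⊎ Fin (suc B) → Fin (suc n)
  from (inj₂ zero)    = zero
  from (inj₁ k)       = suc (T.from (inj₁ k))
  from (inj₂ (suc k)) = suc (T.from (inj₂ k))
  from-cons : ∀ s → from (cons s) ≡ suc (T.from s)
  from-cons (inj₁ _) = refl
  from-cons (inj₂ _) = refl
  invˡ : ∀ s → to (from s) ≡ s
  invˡ (inj₂ zero)    = refl
  invˡ (inj₁ k)       = cong cons (T.strictlyInverseˡ (inj₁ k))
  invˡ (inj₂ (suc k)) = cong cons (T.strictlyInverseˡ (inj₂ k))
  invʳ : ∀ i → from (to i) ≡ i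
  invʳ zero    = refl
  invʳ (suc i) = trans (from-cons (T.to i)) (cong suc (T.strictlyInverseʳ i))
  part : ∀ i → (P i × ∃[ k ] to i ≡ inj₁ k) ⊎ (¬ P i × ∃[ k ] to i ≡ inj₂ k)
  part zero = inj₂ (¬p₀ , zero , refl)
  part (suc i) with T.part i
  ... | inj₁ (p , k , eq)  = inj₁ (p , k , cong cons eq)
  ... | inj₂ (¬p , k , eq) = inj₂ (¬p , suc k , cong cons eq)

lookup-injective : {A : Set} {xs : List A} → Unique xs →
                   ∀ i j → lookup xs i ≡ lookup xs j → i ≡ j
lookup-injective (x∉ ∷ !xs) zero    zero    eq = refl
lookup-injective (x∉ ∷ !xs) zero    (suc j) eq = contradiction eq (All.lookup x∉ (∈-lookup j))
lookup-injective (x∉ ∷ !xs) (suc i) zero    eq = contradiction (sym eq) (All.lookup x∉ (∈-lookup i))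
lookup-injective (x∉ ∷ !xs) (suc i) (suc j) eq = cong suc (lookup-injective !xs i j eq)

-- Each entry picks a preimage in `Q`, and distinct entries pick distinct ones; numbering `Q` by
-- `partition` turns this into an injection between finite types.
length-Unique-≤ : {A : Set} {xs : List A} → Unique xs → (f : Fin n → A) (Q? : Decidable Q) →
                  (∀ {x} → x ∈ xs → ∃[ i ] Q i × f i ≡ x) → length xs ≤ # Q?
length-Unique-≤ {n} {Q = Q} {xs = xs} !xs f Q? preimage = Fin.injective⇒≤ {f = proj₁ ∘ index} index-injective
  where
  open Partition (partition Q?)
  index : ∀ l → ∃[ k ] f (from (inj₁ k)) ≡ lookup xs l
  index l with i , q , fi≡ ← preimage (∈-lookup {xs = xs} l) | part i
  ... | inj₁ (_ , k , eq) = k , trans (cong f (trans (cong from (sym eq)) (strictlyInverseʳ i))) fi≡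
  ... | inj₂ (¬q , _)     = contradiction q ¬q
  index-injective : ∀ {l m} → proj₁ (index l) ≡ proj₁ (index m) → l ≡ m
  index-injective {l} {m} eq = lookup-injective !xs l m
    (trans (sym (proj₂ (index l))) (trans (cong (f ∘ from ∘ inj₁) eq) (proj₂ (index m))))

-- Thinning a graph to colour stars without losing a colour at any vertex.

module _ {n} (c : Fin n → Fin n → ℕ) (c-sym : ∀ u v → c u v ≡ c v u) where

  Lone : SimpleGraph (Fin n) → Fin n → Fin n → Set
  Lone H v u = ∀ w → SimpleGraph.Adj H v w → c v w ≡ c v u → w ≡ u

  -- Every colour component is a star: a lone end of an edge is a leaf of its component.
  Starry : SimpleGraph (Fin n) → Set
  Starry H = ∀ {u v} → SimpleGraph.Adj H u v → Lone H u v ⊎ Lone H v u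

  lone-or-not : ∀ H v u → Lone H v u ⊎ (∃[ w ] SimpleGraph.Adj H v w × c v w ≡ c v u × w ≢ u)
  lone-or-not H v u
    with Fin.any? (λ w → H.adj? v w ×-dec c v w ≟ c v u ×-dec ¬? (w Fin.≟ u))
    where module H = SimpleGraph H
  ... | yes other = inj₂ other
  ... | no ¬other = inj₁ λ w vw same → decidable-stable (w Fin.≟ u) λ w≢u → ¬other (w , vw , same , w≢u)

  lone? : ∀ H v u → Dec (Lone H v u)
  lone? H v u with lone-or-not H v u
  ... | inj₁ lone                   = yes lone
  ... | inj₂ (w , vw , same , w≢u) = no λ lone → w≢u (lone w vw same)

  record ColourSpanning (H G : SimpleGraph (Fin n)) : Set where
    private
      module H = SimpleGraph H
      module G = SimpleGraph G
    field
      sub   : ∀ {u v} → H.Adj u v → G.Adj u v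
      spans : ∀ {u v} → G.Adj u v → ∃[ w ] H.Adj u w × c u w ≡ c u v

  module _ (G : SimpleGraph (Fin n)) where
    private module G = SimpleGraph G

    -- At `u` the colour of `uv` survives on `uu′`, at `v` on `vv′`; every other vertex keeps all
    -- its edges.
    deleteEdge-spanning : ∀ {H} → ColourSpanning H G → ∀ {u v} → SimpleGraph.Adj H u v →
                          (∃[ w ] SimpleGraph.Adj H u w × c u w ≡ c u v × w ≢ v) →
                          (∃[ w ] SimpleGraph.Adj H v w × c v w ≡ c v u × w ≢ u) →
                          ColourSpanning (deleteEdge H u v) G
    deleteEdge-spanning {H} H⊆G {u} {v} uv (u′ , uu′ , uu′≡uv , u′≢v) (v′ , vv′ , vv′≡vu , v′≢u) = record
      { sub   = λ (xy , _) → sub xy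
      ; spans = spans′
      }
      where
      open ColourSpanning H⊆G
      module H = SimpleGraph H
      module H′ = SimpleGraph (deleteEdge H u v)
      u≢v : u ≢ v
      u≢v u≡v = H.irrefl u≡v uv
      spans′ : ∀ {x y} → G.Adj x y → ∃[ w ] H′.Adj x w × c x w ≡ c x y
      spans′ {x} xy with w , xw , xw≡xy ← spans xy
                       | (x Fin.≟ u) ×-dec (w Fin.≟ v) | (x Fin.≟ v) ×-dec (w Fin.≟ u)
      ... | yes (refl , refl) | _ =
        u′ , (uu′ , (λ (_ , p) → u′≢v p) , λ (p , _) → u≢v p) , trans uu′≡uv xw≡xy
      ... | no _  | yes (refl , refl) =
        v′ , (vv′ , (λ (p , _) → u≢v (sym p)) , λ (_ , p) → v′≢u p) , trans vv′≡vu xw≡xy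
      ... | no ¬p | no ¬q = w , (xw , ¬p , ¬q) , xw≡xy

    StarryOn : List (Fin n × Fin n) → SimpleGraph (Fin n) → Set
    StarryOn L H = ∀ {u v} → (u , v) ∈ L → SimpleGraph.Adj H u v → Lone H u v ⊎ Lone H v u
    -- One pass over the pairs is enough: an edge is deleted only if neither end is lone, and an end
    -- that is lone stays lone under further deletions.
    thin : ∀ L → ∃[ H ] ColourSpanning H G × StarryOn L H
    thin [] = G , record { sub = id ; spans = λ {_} {v} uv → v , uv , refl } , λ ()
    thin ((u , v) ∷ L) with thin L
    ... | H , H⊆G , starry with SimpleGraph.adj? H u v | lone-or-not H u v | lone-or-not H v u
    ... | no ¬uv | _ | _ = H , H⊆G , λ
      { (here refl) uv → contradiction uv ¬uv ; (there xy∈) → starry xy∈ }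
    ... | yes _ | inj₁ lone | _ = H , H⊆G , λ
      { (here refl) _ → inj₁ lone ; (there xy∈) → starry xy∈ }
    ... | yes _ | inj₂ _ | inj₁ lone = H , H⊆G , λ
      { (here refl) _ → inj₂ lone ; (there xy∈) → starry xy∈ }
    ... | yes uv | inj₂ uw | inj₂ vw = deleteEdge H u v , deleteEdge-spanning H⊆G uv uw vw , λ
      { (here refl) (_ , ¬uv , _) → contradiction (refl , refl) ¬uv
      ; (there xy∈) (xy , _) → [ inj₁ ∘ shrink , inj₂ ∘ shrink ]′ (starry xy∈ xy) }
      where
      shrink : ∀ {x y} → Lone H x y → Lone (deleteEdge H u v) x y
      shrink lone w (xw , _) = lone w xw

    thinning : ∃[ H ] ColourSpanning H G × Starry H
    thinning with H , H⊆G , starry ← thin (cartesianProduct (allFin n) (allFin n)) =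
      H , H⊆G , λ {u} {v} → starry (∈-cartesianProduct⁺ (∈-allFin u) (∈-allFin v))

-- Colours as a function of two vertices, and a bound on the colour degree.

module _ {n} {G : SimpleGraph (Fin n)} (C : EdgeColouring G) where
  open SimpleGraph G using (Adj; adj?)
  open EdgeColouring C

  -- 0 on non-edges.
  colourOf : Fin n → Fin n → ℕ
  colourOf u v = Maybe.fromMaybe 0 (Maybe.map colour (dec⇒maybe (adj? u v)))

  colourOf-≡ : ∀ {u v} (uv : Adj u v) → colourOf u v ≡ colour uv
  colourOf-≡ {u} {v} uv with adj? u v
  -- `undirected` compares an edge only with a reversal, so two proofs of adjacency are compared
  -- through `vu`.
  ... | yes uv′ = trans (undirected uv′ vu) (sym (undirected uv vu))
    where vu = SimpleGraph.sym G uv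
  ... | no ¬uv  = contradiction uv ¬uv

  colourOf-sym : ∀ u v → colourOf u v ≡ colourOf v u
  colourOf-sym u v with adj? u v | adj? v u
  ... | yes uv | yes vu = undirected uv vu
  ... | yes uv | no ¬vu = contradiction (SimpleGraph.sym G uv) ¬vu
  ... | no ¬uv | yes vu = contradiction (SimpleGraph.sym G vu) ¬uv
  ... | no _   | no _   = refl

  -- The counting reaches `colourDegree` only through this bound: `Q` holds an edge end for each
  -- colour at `v`, and the deduplicated colours have distinct preimages in it.
  colourDegree-≤ : ∀ v (Q? : Decidable Q) →
                   (∀ {u} → Adj v u → ∃[ w ] Q w × colourOf v w ≡ colourOf v u) →
                   colourDegree C v ≤ # Q?
  colourDegree-≤ {Q = Q} v Q? represent = length-Unique-≤ (deduplicate-! _≟_ colours) (colourOf v) Q?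
    λ x∈ → All.lookup represented (∈-deduplicate⁻ _≟_ colours x∈)
    where
    colours = incidentColours C v
    Represented : ℕ → Set
    Represented x = ∃[ w ] Q w × colourOf v w ≡ x
    at : ∀ u → Maybe.All Represented (Maybe.map colour (dec⇒maybe (adj? v u)))
    at u with adj? v u | represent {u}
    ... | yes vu | r with w , q , eq ← r vu = Maybe.just (w , q , eq)
    ... | no _   | _ = Maybe.nothing
    represented : All Represented colours
    represented = All.mapMaybe⁺ (All.map⁺ (All.universal at (allFin n)))

  -- A disjunction to be split on, stated for any graph on the same vertices because subgraphs
  -- inherit it.
  NonRainbow : SimpleGraph (Fin n) → Set
  NonRainbow H = ∀ {x y z} → H.Adj x y → H.Adj y z → H.Adj x z → 
    colourOf x y ≡ colourOf y z ⊎ colourOf y z ≡ colourOf x z ⊎ colourOf x y ≡ colourOf x z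
    where module H = SimpleGraph H

  nonRainbow : ¬ HasRainbowTriangle C → NonRainbow G
  nonRainbow ¬rainbow {x} {y} {z} xy yz xz
    with colourOf x y ≟ colourOf y z | colourOf y z ≟ colourOf x z | colourOf x y ≟ colourOf x z
  ... | yes p | _     | _     = inj₁ p
  ... | no _  | yes q | _     = inj₂ (inj₁ q)
  ... | no _  | no _  | yes r = inj₂ (inj₂ r)
  ... | no p  | no q  | no r  = contradiction
    (x , y , z , xy , yz , xz , differ p xy yz , differ q yz xz , differ r xy xz) ¬rainbow
    where
    differ : ∀ {a b d e} → colourOf a b ≢ colourOf d e → (ab : Adj a b) (de : Adj d e) → colour ab ≢ colour de
    differ ≢ ab de eq = ≢ (trans (colourOf-≡ ab) (trans eq (sym (colourOf-≡ de))))

-- Recognising `K₄-e` and `K₄` from a 4-cycle with a chord.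

module _ {V : Set} (G : SimpleGraph V) (φ : V ↔ (Fin 2 ⊎ Fin 2)) where
  private
    module G = SimpleGraph G
    ψ : V ↔ Fin 4
    ψ = ↔-trans φ (↔-sym (Fin.+↔⊎ {2} {2}))
    open Inverse ψ
    module φ = Inverse φ

    ≅-via-ψ : ∀ {K} → (∀ i j → G.Adj (from i) (from j) ⇔ SimpleGraph.Adj K i j) → G ≅ K
    ≅-via-ψ {K} adj = record
      { vertices  = ψ
      ; adjacency = λ u v → subst₂ (λ x y → G.Adj x y ⇔ SimpleGraph.Adj K (to u) (to v))
                               (strictlyInverseʳ u) (strictlyInverseʳ v) (adj (to u) (to v))
      }

  -- `ψ` numbers the left part 0 and 1, the pair missing in `K₄-e`. All other pairs are edges by
  -- hypothesis, so adjacency of the left pair decides between the two graphs.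
  quadrilateral : (∀ i j → G.Adj (φ.from (inj₁ i)) (φ.from (inj₂ j))) →
                  G.Adj (φ.from (inj₂ zero)) (φ.from (inj₂ (suc zero))) →
                  G ≅ K₄-e ⊎ G ≅ K₄
  quadrilateral cross right = by-left (G.adj? (from 0F) (from 1F))
    where
    edges : ∀ i j → SimpleGraph.Adj K₄-e i j → G.Adj (from i) (from j)
    edges 0F 0F (i≢j , _)    = contradiction refl i≢j
    edges 0F 1F (_ , ¬e , _) = contradiction (refl , refl) ¬e
    edges 0F 2F _            = cross 0F 0F
    edges 0F 3F _            = cross 0F 1F
    edges 1F 0F (_ , _ , ¬e) = contradiction (refl , refl) ¬e
    edges 1F 1F (i≢j , _)    = contradiction refl i≢j
    edges 1F 2F _            = cross 1F 0F
    edges 1F 3F _            = cross 1F 1F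
    edges 2F 0F _            = G.sym (cross 0F 0F)
    edges 2F 1F _            = G.sym (cross 1F 0F)
    edges 2F 2F (i≢j , _)    = contradiction refl i≢j
    edges 2F 3F _            = right
    edges 3F 0F _            = G.sym (cross 0F 1F)
    edges 3F 1F _            = G.sym (cross 1F 1F)
    edges 3F 2F _            = G.sym right
    edges 3F 3F (i≢j , _)    = contradiction refl i≢j

    distinct : ∀ {i j} → G.Adj (from i) (from j) → i ≢ j
    distinct ij i≡j = G.irrefl (cong from i≡j) ij

    by-left : Dec (G.Adj (from 0F) (from 1F)) → G ≅ K₄-e ⊎ G ≅ K₄
    by-left (no ¬left) = inj₁ (≅-via-ψ λ i j → mk⇔
      (λ ij → distinct ij , (λ { (refl , refl) → ¬left ij }) , λ { (refl , refl) → ¬left (G.sym ij) })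
      (edges i j))
    by-left (yes left) = inj₂ (≅-via-ψ λ i j → mk⇔ distinct (all-edges i j))
      where
      all-edges : ∀ i j → i ≢ j → G.Adj (from i) (from j)
      all-edges i j i≢j with (i Fin.≟ 0F) ×-dec (j Fin.≟ 1F) | (i Fin.≟ 1F) ×-dec (j Fin.≟ 0F)
      ... | yes (refl , refl) | _                 = left
      ... | no _              | yes (refl , refl) = G.sym left
      ... | no ¬p             | no ¬q             = edges i j (i≢j , ¬p , ¬q)

-- Counting in the thinned subgraph `H`.

module Thinned {n} {G : SimpleGraph (Fin n)} (C : EdgeColouring G)
  (half : ∀ v → n ≤ 2 * colourDegree C v) (¬rainbow : ¬ HasRainbowTriangle C)
  {H : SimpleGraph (Fin n)} (H⊆G : ColourSpanning (colourOf C) (colourOf-sym C) H G)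
  (starry : Starry (colourOf C) (colourOf-sym C) H)
  where

  open SimpleGraph H using (Adj; adj?)
  open ColourSpanning H⊆G
  private
    module G = SimpleGraph G
    module H = SimpleGraph H

  c : Fin n → Fin n → ℕ
  c = colourOf C

  c-sym : ∀ u v → c u v ≡ c v u
  c-sym = colourOf-sym C

  Leaf : Fin n → Fin n → Set
  Leaf = Lone c c-sym H

  leaf? : ∀ v u → Dec (Leaf v u)
  leaf? = lone? c c-sym H

  triangle : NonRainbow C H
  triangle xy yz xz = nonRainbow C ¬rainbow (sub xy) (sub yz) (sub xz)

  degree : Fin n → ℕ
  degree v = # (adj? v)

  -- `spans` moves each representative into `H`, so from here on colours are counted along edges of
  -- `H` alone.
  colours-≤ : ∀ v (Q? : Decidable Q) → (∀ {u} → Adj v u → ∃[ w ] Q w × c v w ≡ c v u) →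
              n ≤ 2 * # Q?
  colours-≤ v Q? represent = ≤-trans (half v) (*-monoʳ-≤ 2 (colourDegree-≤ C v Q? λ vu →
    let w , vw , w≡u = spans vu ; x , q , x≡w = represent vw in x , q , trans x≡w w≡u))

  -- `v` is the centre of the colour star of `vy`, which has at least two edges.
  Fork : Fin n → Fin n → Set
  Fork v y = Adj v y × ¬ Leaf v y

  fork? : ∀ v → Decidable (Fork v)
  fork? v y = adj? v y ×-dec ¬? (leaf? v y)

  -- Here `y` is the centre of the star: `Centre v y` and `Fork y v` describe the same edge, which
  -- the double count uses.
  Centre : Fin n → Fin n → Set
  Centre v y = Adj v y × ¬ Leaf y v

  centre? : ∀ v → Decidable (Centre v)
  centre? v y = adj? v y ×-dec ¬? (leaf? y v)

  centre⇒leaf : ∀ {v y} → Centre v y → Leaf v y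
  centre⇒leaf (vy , ¬leaf) with starry vy
  ... | inj₁ leaf = leaf
  ... | inj₂ leaf = contradiction leaf ¬leaf

  First : Fin n → Fin n → Set
  First v u = ∀ w → w Fin.< u → ¬ (Adj v w × c v w ≡ c v u)

  first? : ∀ v → Decidable (First v)
  first? v u = Fin.all? λ w → (w Fin.<? u) →-dec ¬? (adj? v w ×-dec c v w ≟ c v u)

  -- The colours at v are represented both by the first edges of each colour and by the
  -- edges which are leaves or not first; an edge of both kinds is a leaf.
  fork-≤ : ∀ v → n + # (fork? v) ≤ 2 * degree v
  fork-≤ v = begin
    n + f                              ≤⟨ +-monoˡ-≤ f n≤A+B ⟩
    # A? + # B? + f                    ≡⟨ cong (_+ f) (#-∪-∩ A? B?) ⟨
    # (A? ∪? B?) + # (A? ∩? B?) + f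
      ≤⟨ +-monoˡ-≤ f (+-mono-≤ (#-mono (A? ∪? B?) (adj? v) [ proj₁ , proj₁ ]′)
                               (#-mono (A? ∩? B?) L? A∩B⊆L)) ⟩
    degree v + # L? + f                ≡⟨ +-assoc (degree v) (# L?) f ⟩
    degree v + (# L? + f)              ≡⟨ cong (degree v +_) (#-∪-∩ L? (fork? v)) ⟨
    degree v + (# (L? ∪? fork? v) + # (L? ∩? fork? v))
      ≡⟨ cong (λ k → degree v + (# (L? ∪? fork? v) + k))
              (#-empty (L? ∩? fork? v) λ _ ((_ , leaf) , _ , ¬leaf) → ¬leaf leaf) ⟩
    degree v + (# (L? ∪? fork? v) + 0)
      ≤⟨ +-monoʳ-≤ (degree v) (+-monoˡ-≤ 0 (#-mono (L? ∪? fork? v) (adj? v) [ proj₁ , proj₁ ]′)) ⟩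
    2 * degree v                       ∎
    where
    open ≤-Reasoning
    f = # (fork? v)
    A B L : Pred (Fin n) 0ℓ
    A u = Adj v u × First v u
    B u = Adj v u × (Leaf v u ⊎ ¬ First v u)
    L u = Adj v u × Leaf v u
    A? : Decidable A
    A? u = adj? v u ×-dec first? v u
    B? : Decidable B
    B? u = adj? v u ×-dec (leaf? v u ⊎-dec ¬? (first? v u))
    A∩B⊆L : A ∩ B ⊆ L
    A∩B⊆L ((vu , first) , (_ , inj₁ leaf))   = vu , leaf
    A∩B⊆L ((vu , first) , (_ , inj₂ ¬first)) = contradiction first ¬first
    L? : Decidable L
    L? u = adj? v u ×-dec leaf? v u
    A-represents : ∀ {u} → Adj v u → ∃[ w ] A w × c v w ≡ c v u
    A-represents {u} vu
      with w , (vw , w≡u) , below ← least (λ w → adj? v w ×-dec c v w ≟ c v u) (u , vu , refl) =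
      w , (vw , λ x x<w (vx , x≡w) → below x x<w (vx , trans x≡w w≡u)) , w≡u
    B-represents : ∀ {u} → Adj v u → ∃[ w ] B w × c v w ≡ c v u
    B-represents {u} vu with first? v u | lone-or-not c c-sym H v u
    ... | no ¬first | _         = u , (vu , inj₂ ¬first) , refl
    ... | yes _     | inj₁ leaf = u , (vu , inj₁ leaf) , refl
    -- A first edge that is not lone has a second edge of its colour, at a larger index and hence
    -- not first.
    ... | yes first | inj₂ (w , vw , w≡u , w≢u) =
      w , (vw , inj₂ λ first′ → first′ u u<w (vu , sym w≡u)) , w≡u
      where
      u<w : u Fin.< w
      u<w = Fin.≤∧≢⇒< (≮⇒≥ λ w<u → first w w<u (vw , w≡u)) (w≢u ∘ sym)
    n≤A+B : n ≤ # A? + # B?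
    n≤A+B = *-cancelˡ-≤ 2 (begin
      2 * n                  ≡⟨ cong (n +_) (+-identityʳ n) ⟩
      n + n                  ≤⟨ +-mono-≤ (colours-≤ v A? A-represents) (colours-≤ v B? B-represents) ⟩
      2 * # A? + 2 * # B?    ≡⟨ *-distribˡ-+ 2 (# A?) (# B?) ⟨
      2 * (# A? + # B?)      ∎)

  -- Upper bounds on the degree from twins.

  Twin : Fin n → Fin n → Fin n → Set
  Twin x v y = Adj v y × Adj x y × c x y ≡ c v y

  twin? : ∀ x v → Decidable (Twin x v)
  twin? x v y = adj? v y ×-dec adj? x y ×-dec c x y ≟ c v y

  -- Were `vy` lone at `y`, the edge `yx` of the same colour would give `x ≡ v`, against the edge
  -- `xv`.
  twin⇒centre : ∀ {x v y} → Adj x v → Twin x v y → Centre v y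
  twin⇒centre {x} {v} {y} xv (vy , xy , xy≡vy) = vy , λ leaf →
    H.irrefl (leaf x (H.sym xy) (trans (c-sym y x) (trans xy≡vy (c-sym v y)))) xv

  -- A colour of x other than that of xv leads outside the neighbourhood of v or to a twin,
  -- and v, being a non-neighbour of itself, represents the colour of xv.
  degree-≤-twins : ∀ {x v} → Adj x v → Leaf v x → 2 * degree v ≤ n + 2 * # (twin? x v)
  degree-≤-twins {x} {v} xv leaf = +-cancelˡ-≤ n _ _ (begin
    n + 2 * d              ≤⟨ +-monoˡ-≤ (2 * d) (colours-≤ x Q? represent) ⟩
    2 * # Q? + 2 * d       ≤⟨ +-monoˡ-≤ (2 * d) (*-monoʳ-≤ 2 Q≤) ⟩
    2 * (e + t) + 2 * d    ≡⟨ regroup d e t ⟩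
    2 * (d + e) + 2 * t    ≡⟨ cong (λ k → 2 * k + 2 * t) (#-∁ (adj? v)) ⟩
    2 * n + 2 * t          ≡⟨ regroup′ n t ⟩
    n + (n + 2 * t)        ∎)
    where
    open ≤-Reasoning
    Q? = ∁? (adj? v) ∪? twin? x v
    d = degree v
    e = # (∁? (adj? v))
    t = # (twin? x v)
    Q≤ : # Q? ≤ e + t
    Q≤ = ≤-trans (m≤m+n (# Q?) _) (≤-reflexive (#-∪-∩ (∁? (adj? v)) (twin? x v)))
    regroup : ∀ d e t → 2 * (e + t) + 2 * d ≡ 2 * (d + e) + 2 * t
    regroup = solve-∀
    regroup′ : ∀ n t → 2 * n + 2 * t ≡ n + (n + 2 * t)
    regroup′ = solve-∀
    represent : ∀ {u} → Adj x u → ∃[ w ] (∁ (Adj v) ∪ Twin x v) w × c x w ≡ c x u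
    represent {u} xu with c x v ≟ c x u | adj? v u
    ... | yes xv≡xu | _      = v , inj₁ (H.irrefl refl) , xv≡xu
    ... | no _      | no ¬vu = u , inj₁ ¬vu , refl
    -- In the triangle on `x`, `u`, `v` the colour of `xv` occurs neither on `uv`, being lone at
    -- `v`, nor on `xu`; so `xu` and `uv` agree and `u` is a twin.
    ... | no xv≢xu  | yes vu with triangle xu (H.sym vu) xv
    ...   | inj₁ xu≡uv        = u , inj₂ (vu , xu , trans xu≡uv (c-sym u v)) , refl
    ...   | inj₂ (inj₁ uv≡xv) = contradiction xu
      (H.irrefl (sym (leaf u vu (trans (c-sym v u) (trans uv≡xv (c-sym x v))))))
    ...   | inj₂ (inj₂ xu≡xv) = contradiction (sym xu≡xv) xv≢xu

  -- A twin would be a centre, so `degree-≤-twins` along an edge lone at `v` gives the bound. If no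
  -- edge is lone at `v`, all of them are forks and `fork-≤` would make the degree at least n.
  no-centre⇒degree-≤ : ∀ v → (∀ y → ¬ Centre v y) → 2 * degree v ≤ n
  no-centre⇒degree-≤ v ¬centre with Fin.any? (λ x → adj? x v ×-dec leaf? v x)
  ... | yes (x , xv , leaf) = begin
    2 * degree v              ≤⟨ degree-≤-twins xv leaf ⟩
    n + 2 * # (twin? x v)     ≡⟨ cong (λ k → n + 2 * k) (#-empty (twin? x v) λ y → ¬centre y ∘ twin⇒centre xv) ⟩
    n + 0                     ≡⟨ +-identityʳ n ⟩
    n                         ∎
    where open ≤-Reasoning
  ... | no ¬leaf = contradiction n≤d (<⇒≱ d<n)
    where
    open ≤-Reasoning
    n≤d : n ≤ degree v
    n≤d = +-cancelʳ-≤ (degree v) _ _ (begin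
      n + degree v   
        ≤⟨ +-monoʳ-≤ n (#-mono (adj? v) (fork? v) λ {x} vx → vx , λ leaf → ¬leaf (x , H.sym vx , leaf)) ⟩
      n + # (fork? v)    ≤⟨ fork-≤ v ⟩
      2 * degree v       ≡⟨ cong (degree v +_) (+-identityʳ _) ⟩
      degree v + degree v ∎)
    d<n : degree v < n
    d<n = ≤-<-trans (m≤m+n (degree v) _)
      (#-disjoint-< (adj? v) (λ _ → no id) (λ _ → proj₂) v (H.irrefl refl) id)

  -- Averages degree-≤-twins over the centres x of v: being a twin is an asymmetric relation
  -- on those centres, so the sum of the numbers of twins is less than a² / 2.
  centre⇒degree-< : ∀ v {x₀} → Centre v x₀ → 2 * degree v < n + # (centre? v)
  centre⇒degree-< v {x₀} centre₀ = *-cancelˡ-< a _ _ (begin-strict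
    a * (2 * d)                                             ≡⟨ *-distribʳ-sum (2 * d) [A] ⟩
    sum (λ x → [A] x * (2 * d))                             ≤⟨ sum-mono-≤ at ⟩
    sum (λ x → [A] x * n + (# (arc? x) + # (arc? x)))       ≡⟨ ∑-distrib-+ (λ x → [A] x * n) (λ x → # (arc? x) + # (arc? x)) ⟩
    sum (λ x → [A] x * n) + sum (λ x → # (arc? x) + # (arc? x))
      ≡⟨ cong₂ _+_ (sym (*-distribʳ-sum n [A])) (∑-distrib-+ (λ x → # (arc? x)) (λ x → # (arc? x))) ⟩
    a * n + (arcs + arcs)                                   <⟨ +-monoʳ-< (a * n) arcs+arcs<a*a ⟩
    a * n + a * a                                           ≡⟨ *-distribˡ-+ a n a ⟨
    a * (n + a)                                             ∎)
    where
    open ≤-Reasoning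
    d = degree v
    a = # (centre? v)
    [A] : Fin n → ℕ
    [A] x = 𝟙 (centre? v x)
    Arc : Fin n → Fin n → Set
    Arc x y = Centre v x × Centre v y × Twin x v y
    arc? : ∀ x → Decidable (Arc x)
    arc? x y = centre? v x ×-dec centre? v y ×-dec twin? x v y
    arcs = sum (λ x → # (arc? x))
    at : ∀ x → [A] x * (2 * d) ≤ [A] x * n + (# (arc? x) + # (arc? x))
    at x = 𝟙-*-≤ (centre? v x) {l = n} λ x∈ → ≤-trans (degree-≤-twins (H.sym (proj₁ x∈)) (centre⇒leaf x∈))
      (+-monoʳ-≤ n (≤-trans
        (*-monoʳ-≤ 2 (#-mono (twin? x v) (arc? x) λ twin → x∈ , twin⇒centre (H.sym (proj₁ x∈)) twin , twin))
        (≤-reflexive (cong (# (arc? x) +_) (+-identityʳ _)))))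
    -- Twins of each other would give `vx` and `vy` the common colour of `xy`, but `vx` is lone at
    -- `v` because `x` is a centre.
    antisym : ∀ {x y} → Arc x y → ¬ Arc y x
    antisym {x} {y} (x∈ , _ , (vy , xy , xy≡vy)) (_ , _ , (vx , yx , yx≡vx)) =
      H.irrefl (sym (centre⇒leaf x∈ y vy (trans (sym xy≡vy) (trans (c-sym x y) yx≡vx)))) xy
    pair : ∀ x y → 𝟙 (arc? x y) + 𝟙 (arc? y x) ≤ [A] x * [A] y
    pair x y = ≤-trans
      (𝟙-disjoint (arc? x y) (arc? y x) (centre? v x ×-dec centre? v y)
        (λ (x∈ , y∈ , _) → x∈ , y∈) (λ (y∈ , x∈ , _) → x∈ , y∈) λ (xy , yx) → antisym xy yx)
      (≤-reflexive (𝟙-× (centre? v x) (centre? v y)))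
    -- The diagonal supplies the strictness: no arc goes from `x₀` to itself, yet this pair counts
    -- once in the square.
    pair₀ : 𝟙 (arc? x₀ x₀) + 𝟙 (arc? x₀ x₀) < [A] x₀ * [A] x₀
    pair₀ rewrite 𝟙-no (arc? x₀ x₀) (λ arc → antisym arc arc) | 𝟙-yes (centre? v x₀) centre₀ = ≤-refl
    arcs+arcs<a*a : arcs + arcs < a * a
    arcs+arcs<a*a = begin-strict
      arcs + arcs                                                     ≡⟨ cong (arcs +_) (∑-comm λ x y → 𝟙 (arc? x y)) ⟩
      arcs + sum (λ x → sum (λ y → 𝟙 (arc? y x)))
        ≡⟨ ∑-distrib-+ (λ x → # (arc? x)) (λ x → sum (λ y → 𝟙 (arc? y x))) ⟨
      sum (λ x → # (arc? x) + sum (λ y → 𝟙 (arc? y x)))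
        ≡⟨ (sum-cong-≗ λ x → ∑-distrib-+ (λ y → 𝟙 (arc? x y)) (λ y → 𝟙 (arc? y x))) ⟨
      sum (λ x → sum (λ y → 𝟙 (arc? x y) + 𝟙 (arc? y x)))
        <⟨ sum-mono-< (λ x → sum-mono-≤ (pair x)) x₀ (sum-mono-< (pair x₀) x₀ pair₀) ⟩
      sum (λ x → sum (λ y → [A] x * [A] y))                           ≡⟨ (sum-cong-≗ λ x → *-distribˡ-sum ([A] x) [A]) ⟨
      sum (λ x → [A] x * a)                                           ≡⟨ *-distribʳ-sum a [A] ⟨
      a * a                                                           ∎

  -- Reversing an edge turns a centre into a fork. Summed over all vertices, `fork-≤` then puts
  -- twice the degree at or above n plus the number of centres, while a single centre would put it
  -- strictly below.
  ¬centre : ∀ v y → ¬ Centre v y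
  ¬centre v₀ y₀ centre₀ = <-irrefl refl (begin-strict
    sum (λ v → n + # (centre? v))                  ≡⟨ ∑-distrib-+ (λ _ → n) (λ v → # (centre? v)) ⟩
    sum {n} (λ _ → n) + sum (λ v → # (centre? v))  ≤⟨ +-monoʳ-≤ (sum {n} (λ _ → n)) centres≤forks ⟩
    sum {n} (λ _ → n) + sum (λ v → # (fork? v))    ≡⟨ ∑-distrib-+ (λ _ → n) (λ v → # (fork? v)) ⟨
    sum (λ v → n + # (fork? v))                    ≤⟨ sum-mono-≤ fork-≤ ⟩
    sum (λ v → 2 * degree v)                       <⟨ sum-mono-< bound v₀ (centre⇒degree-< v₀ centre₀) ⟩
    sum (λ v → n + # (centre? v))                  ∎)
    where
    open ≤-Reasoning
    centres≤forks : sum (λ v → # (centre? v)) ≤ sum (λ v → # (fork? v))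
    centres≤forks = ≤-trans (≤-reflexive (∑-comm λ v y → 𝟙 (centre? v y)))
      (sum-mono-≤ λ y → sum-mono-≤ λ v →
        𝟙-mono (centre? v y) (fork? y v) λ (vy , ¬leaf) → H.sym vy , ¬leaf)
    bound : ∀ v → 2 * degree v ≤ n + # (centre? v)
    bound v with Fin.any? (centre? v)
    ... | yes (_ , centre) = <⇒≤ (centre⇒degree-< v centre)
    ... | no ¬centre       = ≤-trans (no-centre⇒degree-≤ v λ y centre → ¬centre (y , centre)) (m≤m+n n _)

  -- `H` is a balanced complete bipartite graph.

  all-leaves : ∀ {v y} → Adj v y → Leaf v y
  -- If `vy` were a fork at `v`, then `v` would be a centre for `y`; hence the colouring of `H` is
  -- proper.
  all-leaves {v} {y} vy = decidable-stable (leaf? v y) λ ¬leaf → ¬centre y v (H.sym vy , ¬leaf)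

  2*degree : ∀ v → 2 * degree v ≡ n
  2*degree v = ≤-antisym (no-centre⇒degree-≤ v (¬centre v)) (≤-trans (m≤m+n n _) (fork-≤ v))

  degree+degree : ∀ u v → degree u + degree v ≡ n
  degree+degree u v = begin
    degree u + degree v        ≡⟨ cong (_+ degree v) (*-cancelˡ-≡ _ _ 2 (trans (2*degree u) (sym (2*degree v)))) ⟩
    degree v + degree v        ≡⟨ cong (degree v +_) (+-identityʳ _) ⟨
    2 * degree v               ≡⟨ 2*degree v ⟩
    n                          ∎
    where open ≡-Reasoning

  -- Any two edges of a triangle share a vertex, so under a proper colouring the triangle would be
  -- rainbow.
  triangle-free : ∀ {x y z} → Adj x y → Adj y z → ¬ Adj x z
  triangle-free {x} {y} {z} xy yz xz with triangle xy yz xz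
  ... | inj₁ xy≡yz =
    H.irrefl (sym (all-leaves (H.sym xy) z yz (trans (sym xy≡yz) (c-sym x y)))) xz
  ... | inj₂ (inj₁ yz≡xz) =
    H.irrefl (all-leaves (H.sym yz) x (H.sym xz) (trans (c-sym z x) (trans (sym yz≡xz) (c-sym y z)))) xy
  ... | inj₂ (inj₂ xy≡xz) = H.irrefl (all-leaves xz y xy xy≡xz) yz

  -- Adjacent vertices have disjoint neighbourhoods whose sizes add up to n, so the two
  -- neighbourhoods cover all vertices.
  complementary : ∀ {x y} → Adj x y → ∀ {z} → ¬ Adj x z → Adj y z
  complementary {x} {y} xy {z} ¬xz = decidable-stable (adj? y z) λ ¬yz →
    <⇒≢ (#-disjoint-< (adj? x) (adj? y) (λ _ (xw , yw) → triangle-free xy yw xw) z ¬xz ¬yz)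
      (degree+degree x y)

  edge : Fin n → ∃[ x ] ∃[ y ] Adj x y
  edge v with Fin.any? (adj? v)
  ... | yes (y , vy) = v , y , vy
  ... | no ¬vy = ⊥-elim (Fin.¬Fin0 (subst Fin n≡0 v))
    where
    n≡0 : n ≡ 0
    n≡0 = trans (sym (2*degree v)) (cong (2 *_) (#-empty (adj? v) λ y vy → ¬vy (y , vy)))

  -- One part is the neighbourhood of `y`; its complement lies in the neighbourhood of the adjacent
  -- vertex `x`. Both are independent for want of triangles, and `complementary` gives the cross
  -- edges.
  H≅completeBipartite : Fin n → ∃[ k ] n ≡ k * 2 × H ≅ completeBipartite k k
  H≅completeBipartite v₀ with x , y , xy ← edge v₀ =
    degree y , trans (sym (2*degree y)) (*-comm 2 (degree y)) ,
    subst (λ k → H ≅ completeBipartite (degree y) k) #∁≡degree H≅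
    where
    #∁≡degree : # (∁? (adj? y)) ≡ degree y
    #∁≡degree = +-cancelˡ-≡ (degree y) _ _ (trans (#-∁ (adj? y)) (sym (degree+degree y y)))
    open Partition (partition (adj? y))
    H≅ : H ≅ completeBipartite (degree y) (# (∁? (adj? y)))
    H≅ = record { vertices = parts ; adjacency = adjacency }
      where
      module K = SimpleGraph (completeBipartite (degree y) (# (∁? (adj? y))))
      adjacency : ∀ u v → Adj u v ⇔ K.Adj (to u) (to v)
      adjacency u v with part u | part v
      ... | inj₁ (yu , i , ≡i) | inj₁ (yv , j , ≡j) rewrite ≡i | ≡j =
        mk⇔ (λ uv → triangle-free yu uv yv) λ ()
      ... | inj₁ (yu , i , ≡i) | inj₂ (¬yv , j , ≡j) rewrite ≡i | ≡j =
        mk⇔ (λ _ → tt) λ _ → complementary yu ¬yv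
      ... | inj₂ (¬yu , i , ≡i) | inj₁ (yv , j , ≡j) rewrite ≡i | ≡j =
        mk⇔ (λ _ → tt) λ _ → H.sym (complementary yv ¬yu)
      ... | inj₂ (¬yu , i , ≡i) | inj₂ (¬yv , j , ≡j) rewrite ≡i | ≡j =
        mk⇔ (λ uv → triangle-free (complementary (H.sym xy) ¬yu) uv (complementary (H.sym xy) ¬yv)) λ ()

  -- Edges of `G` outside `H`.

  -- Each vertex z opposite an edge xy inside a part carries the colour of xy on xz or on yz,
  -- and at each of x and y only one edge of H has that colour.
  part-≤2 : ∀ {k} (opposite : Fin k → Fin n) → (∀ {i j} → opposite i ≡ opposite j → i ≡ j) →
            ∀ {x y} → G.Adj x y → (∀ i → Adj (opposite i) x) → (∀ i → Adj (opposite i) y) → k ≤ 2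
  part-≤2 {k} opposite injective {x} {y} xy ox oy = Fin.injective⇒≤ {f = end ∘ coloured} λ {i} {j} →
    end-injective i j (coloured i) (coloured j)
    where
    Coloured : Fin k → Set
    Coloured i = c x (opposite i) ≡ c x y ⊎ c y (opposite i) ≡ c x y
    end : ∀ {i} → Coloured i → Fin 2
    end (inj₁ _) = zero
    end (inj₂ _) = suc zero
    end-injective : ∀ i j (p : Coloured i) (q : Coloured j) → end p ≡ end q → i ≡ j
    end-injective i j (inj₁ p) (inj₁ q) _ =
      injective (all-leaves (H.sym (ox j)) (opposite i) (H.sym (ox i)) (trans p (sym q)))
    end-injective i j (inj₂ p) (inj₂ q) _ =
      injective (all-leaves (H.sym (oy j)) (opposite i) (H.sym (oy i)) (trans p (sym q)))
    coloured : ∀ i → Coloured i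
    coloured i with nonRainbow C ¬rainbow xy (G.sym (sub (oy i))) (G.sym (sub (ox i)))
    ... | inj₁ xy≡yz        = inj₂ (sym xy≡yz)
    ... | inj₂ (inj₂ xy≡xz) = inj₁ (sym xy≡xz)
    -- Equal colours on `xz` and `yz` would force `x ≡ y`, since `H` is properly coloured at the
    -- opposite vertex.
    ... | inj₂ (inj₁ yz≡xz) = ⊥-elim (G.irrefl
      (all-leaves (oy i) x (ox i) (trans (c-sym _ x) (trans (sym yz≡xz) (c-sym y _)))) xy)

  -- The edge inside the right part leaves only `k` equal to 2: in a part with one vertex it would
  -- be a loop, and three or more vertices in the left part contradict `part-≤2`.
  inner-edge : ∀ k → n ≡ k * 2 → (φ : Fin n ↔ (Fin k ⊎ Fin k)) → let open Inverse φ in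
               (∀ i j → Adj (from (inj₁ i)) (from (inj₂ j))) →
               ∀ i j → G.Adj (from (inj₂ i)) (from (inj₂ j)) →
               n ≡ 4 × (G ≅ K₄-e ⊎ G ≅ K₄)
  inner-edge 1 _ _ _ zero zero ij = contradiction ij (G.irrefl refl)
  inner-edge 2 n≡4 φ cross i j ij = n≡4 , quadrilateral G φ (λ i j → sub (cross i j)) (right i j ij)
    where
    open Inverse φ
    right : ∀ i j → G.Adj (from (inj₂ i)) (from (inj₂ j)) →
            G.Adj (from (inj₂ zero)) (from (inj₂ (suc zero)))
    right zero       zero       e = contradiction e (G.irrefl refl)
    right zero       (suc zero) e = e
    right (suc zero) zero       e = G.sym e
    right (suc zero) (suc zero) e = contradiction e (G.irrefl refl)
  inner-edge (suc (suc (suc _))) _ φ cross i j ij = contradiction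
    (part-≤2 (from ∘ inj₁) (inj₁-injective ∘ from-injective) ij (λ l → cross l i) (λ l → cross l j))
    λ { (s≤s (s≤s ())) }
    where
    open Inverse φ
    from-injective : ∀ {a b} → from a ≡ from b → a ≡ b
    from-injective eq = trans (sym (strictlyInverseˡ _)) (trans (cong to eq) (strictlyInverseˡ _))

  -- If `G` adds nothing to `H`, it inherits the isomorphism. An added edge lies inside a part,
  -- since `H` has all cross edges; exchanging the parts if necessary places it on the right.
  extremal : ∃[ k ] n ≡ k * 2 × H ≅ completeBipartite k k →
             Dec (∃[ u ] ∃[ v ] G.Adj u v × ¬ Adj u v) →
             (2 ∣ n × G ≅ completeBipartite (n / 2) (n / 2)) ⊎ (n ≡ 4 × (G ≅ K₄-e ⊎ G ≅ K₄))
  extremal (k , n≡k*2 , H≅) (no ¬extra) = inj₁ (divides k n≡k*2 , subst (λ m → G ≅ completeBipartite m m) k≡n/2 G≅)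
    where
    k≡n/2 : k ≡ n / 2
    k≡n/2 = trans (sym (m*n/n≡m k 2)) (cong (_/ 2) (sym n≡k*2))
    open _≅_ H≅
    G≅ : G ≅ completeBipartite k k
    G≅ = record
      { vertices  = vertices
      ; adjacency = λ u v → mk⇔
          (λ uv → Equivalence.to (adjacency u v) (decidable-stable (adj? u v) λ ¬uv → ¬extra (u , v , uv , ¬uv)))
          (λ uv → sub (Equivalence.from (adjacency u v) uv))
      }
  extremal (k , n≡k*2 , H≅) (yes (u , v , uv , ¬uv)) =
    inj₂ (by-parts (to u) (to v) (strictlyInverseʳ u) (strictlyInverseʳ v))
    where
    open _≅_ H≅
    open Inverse vertices
    module K = SimpleGraph (completeBipartite k k)
    lift : ∀ {a b} → K.Adj a b → Adj (from a) (from b)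
    lift {a} {b} ab = Equivalence.from (adjacency (from a) (from b))
      (subst₂ K.Adj (sym (strictlyInverseˡ a)) (sym (strictlyInverseˡ b)) ab)
    by-parts : ∀ a b → from a ≡ u → from b ≡ v → n ≡ 4 × (G ≅ K₄-e ⊎ G ≅ K₄)
    by-parts (inj₂ i) (inj₂ j) refl refl = inner-edge k n≡k*2 vertices (λ _ _ → lift tt) i j uv
    by-parts (inj₁ i) (inj₁ j) refl refl =
      inner-edge k n≡k*2 (↔-trans vertices swapped) (λ _ _ → lift tt) i j uv
      where
      swapped : (Fin k ⊎ Fin k) ↔ (Fin k ⊎ Fin k)
      swapped = mk↔ₛ′ Sum.swap Sum.swap Sum.swap-involutive Sum.swap-involutive
    by-parts (inj₁ i) (inj₂ j) refl refl = contradiction (lift tt) ¬uv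
    by-parts (inj₂ i) (inj₁ j) refl refl = contradiction (lift tt) ¬uv

theorem3 : (n : ℕ) (G : SimpleGraph (Fin n)) (C : EdgeColouring G) →
    (∀ v → n ≤ 2 * colourDegree C v) →
    ¬ HasRainbowTriangle C →
    (2 ∣ n × G ≅ completeBipartite (n / 2) (n / 2)) ⊎
    (n ≡ 4 × (G ≅ K₄-e ⊎ G ≅ K₄))
-- The bipartition is built from a vertex, so the empty graph, which is the complete bipartite graph
-- with two empty parts, is treated apart.
theorem3 zero G C half ¬rainbow = inj₁ (divides 0 refl , record
  { vertices  = Fin.+↔⊎ {0} {0}
  ; adjacency = λ ()
  })
theorem3 (suc n) G C half ¬rainbow =
  let H , H⊆G , starry = thinning (colourOf C) (colourOf-sym C) G
      open Thinned C half ¬rainbow H⊆G starry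
  in extremal (H≅completeBipartite zero)
       (Fin.any? λ u → Fin.any? λ v → SimpleGraph.adj? G u v ×-dec ¬? (SimpleGraph.adj? H u v))
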